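{- Let $n$ be a positive integer, \[A^{\mathrm{Pinwheel}}_n=\begin{pmatrix}0&1\\1&2n\end{pmatrix},\] $L$ a $(p,q)$-leaper with $p<q$, and $M$ an $(r,s)$-leaper with \[\binom rs=A^{\mathrm{Pinwheel}}_n\binom pq.\] Then the pinwheel board $W_n(L)$ of order $n$ for $L$ is dual with respect to $L$ and $M$.
   Context: A square is a unit square of the infinite chessboard; a board is a set of squares. For nonnegative integers $p,q$, not both zero, a $(p,q)$-leaper is a piece that moves from a square $a$ to any of $a+(\pm p,\pm q)$, $a+(\pm q,\pm p)$; a $(p,q)$-leaper and a $(q,p)$-leaper are the same leaper. The leaper graph of $L$ over a board $B$ has the squares of $B$ as vertices, two being adjacent when a move of $L$ joins them. A board $B$ is dual with respect to two distinct leapers $L$ and $M$ if $B$ contains more than one square and the leaper graphs of $L$ and $M$ over $B$ are connected and isomorphic. Pinwheel boards. Given a $(p,q)$-leaper $L$ with $q\ne0$, use Cartesian coordinates with origin $O$ over the infinite chessboard such that the integer points are the vertices of the squares if $p+q$ is odd, and the centers of the squares if $p+q$ is even; $(x,y)$ denotes the square centered at $(x,y)$. Let $N^{\mathrm I}(L)$ be the set of all squares $(x,y)$ with $x\equiv\frac12(p+q)$ and $y\equiv\frac12(p-q)$ modulo $2q$. Let $R^{\mathrm I}_n(L)$ be the rectangle bounded by $p\le x+y\le p+2nq$ and $-(2n-1)q\le y-x\le(2n-1)q$, and let $W^{\mathrm I}_n(L)$ be the board formed by all squares of $N^{\mathrm I}(L)$ whose centers lie on the boundary or in the interior of $R^{\mathrm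 I}_n(L)$. Let $W^{\mathrm{II}}_n(L)$, $W^{\mathrm{III}}_n(L)$, $W^{\mathrm{IV}}_n(L)$ be the rotations of $W^{\mathrm I}_n(L)$ by $90^\circ$, $180^\circ$, and $270^\circ$ counterclockwise about $O$. The pinwheel board of order $n$ for $L$, $W_n(L)$, is the union of $W^{\mathrm I}_n(L)$, $W^{\mathrm{II}}_n(L)$, $W^{\mathrm{III}}_n(L)$, and $W^{\mathrm{IV}}_n(L)$. -}

module Defs where

open import Data.Integer.Base as ℤ using (ℤ; +_; _◃_)
open import Data.Integer.Divisibility.Signed using (_∣_)
open import Data.Nat.Base as ℕ using (ℕ)
open import Data.Nat.DivMod using (_%_)
open import Data.Product.Base using (_×_; _,_; ∃; ∃₂; proj₁)
open import Data.Sign.Base using (Sign)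
open import Data.Sum.Base using (_⊎_)
open import Data.Vec.Base using (Vec; []; _∷_; map; sum; zipWith)
open import Function.Base using (_on_; _∘_)
open import Function.Bundles using (Inverse; _⇔_)
open import Level using (0ℓ)
open import Relation.Binary.Bundles using (Setoid)
open import Relation.Binary.Construct.Closure.ReflexiveTransitive using (Star)
import Relation.Binary.Construct.On as On
import Relation.Binary.Construct.Union as Union
open import Relation.Binary.Core using (Rel)
open import Relation.Binary.PropositionalEquality as ≡ using (_≡_; _≢_)
open import Relation.Nullary.Negation using (¬_)
open import Relation.Unary using (Pred; _∪_; _∩_)

-- Vertices form a setoid because membership in a board need not be
-- proof-irrelevant: two membership proofs of one square are one vertex.
record Graph : Set₁ where
  field
    vertices : Setoid 0ℓ 0ℓ
  open Setoid vertices public using (_≈_) renaming (Carrier to Vertex)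
  field
    Adj : Rel Vertex 0ℓ

-- Any two vertices are joined by a walk; a walk may pass from a vertex to
-- another representative of the same vertex.
Connected : Graph → Set
Connected G = ∀ u v → Star (_≈_ Union.∪ Adj) u v
  where open Graph G

Isomorphic : Graph → Graph → Set
Isomorphic G H =
  ∃ λ (φ : Inverse G.vertices H.vertices) →
    ∀ u v → G.Adj u v ⇔ H.Adj (Inverse.to φ u) (Inverse.to φ v)
  where
  module G = Graph G
  module H = Graph H

-- A square of the chessboard is given by its column and row.
Square : Set
Square = ℤ × ℤ

Board : Set₁
Board = Pred Square 0ℓ

-- A leaper presented by an ordered pair (p , q); _≈ᴸ_ identifies the
-- presentations (p , q) and (q , p).
record Leaper : Set where
  constructor leaper
  field
    p q           : ℕ
    not-both-zero : ¬ (p ≡ 0 × q ≡ 0)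

open Leaper public using (p; q)

infix 4 _≈ᴸ_

_≈ᴸ_ : Rel Leaper 0ℓ
L ≈ᴸ M = (p L ≡ p M × q L ≡ q M) ⊎ (p L ≡ q M × q L ≡ p M)

translate : Square → ℤ × ℤ → Square
translate (x , y) (dx , dy) = x ℤ.+ dx , y ℤ.+ dy

Move : Leaper → Rel Square 0ℓ
Move L a b = ∃₂ λ (s t : Sign) →
  b ≡ translate a (s ◃ p L , t ◃ q L) ⊎ b ≡ translate a (s ◃ q L , t ◃ p L)

leaperGraph : Leaper → Board → Graph
leaperGraph L B = record
  { vertices = On.setoid (≡.setoid Square) (proj₁ {B = B})
  ; Adj      = Move L on proj₁
  }

record Dual (B : Board) (L M : Leaper) : Set where
  field
    distinct   : ¬ (L ≈ᴸ M)
    nontrivial : ∃₂ λ a b → B a × B b × a ≢ b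
    connectedˡ : Connected (leaperGraph L B)
    connectedʳ : Connected (leaperGraph M B)
    isomorphic : Isomorphic (leaperGraph L B) (leaperGraph M B)

-- The centre of a square in the coordinate system attached to L, with both
-- coordinates doubled to stay integral.  The square (0 , 0) is centred at the
-- origin if p + q is even, and at (½ , ½) if p + q is odd.
-- All the conditions on centres below are doubled accordingly.
centre : Leaper → Square → ℤ × ℤ
centre L (a , b) = + 2 ℤ.* a ℤ.+ + e , + 2 ℤ.* b ℤ.+ + e
  where
  e : ℕ
  e = (p L ℕ.+ q L) % 2

-- x ≡ ½ (p + q) and y ≡ ½ (p - q) modulo 2 q
N¹ : Leaper → Board
N¹ L a =
  let X , Y = centre L a
      p̂ = + p L
      q̂ = + q L
  in (+ 4 ℤ.* q̂ ∣ X ℤ.- (p̂ ℤ.+ q̂)) × (+ 4 ℤ.* q̂ ∣ Y ℤ.- (p̂ ℤ.- q̂))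

-- p ≤ x + y ≤ p + 2 n q and - (2 n - 1) q ≤ y - x ≤ (2 n - 1) q
R¹ : ℕ → Leaper → Board
R¹ n L a =
  let X , Y = centre L a
      p̂ = + p L
      q̂ = + q L
      d = (+ 2 ℤ.* + n ℤ.- + 1) ℤ.* q̂
  in + 2 ℤ.* p̂ ℤ.≤ X ℤ.+ Y
   × X ℤ.+ Y ℤ.≤ + 2 ℤ.* (p̂ ℤ.+ + 2 ℤ.* + n ℤ.* q̂)
   × ℤ.- (+ 2 ℤ.* d) ℤ.≤ Y ℤ.- X
   × Y ℤ.- X ℤ.≤ + 2 ℤ.* d

W¹ : ℕ → Leaper → Board
W¹ n L = N¹ L ∩ R¹ n L

-- Counterclockwise by 90° about the origin.
rot90 : ℤ × ℤ → ℤ × ℤ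
rot90 (x , y) = ℤ.- y , x

image : Leaper → (ℤ × ℤ → ℤ × ℤ) → Board → Board
image L ρ B a = ∃ λ b → B b × centre L a ≡ ρ (centre L b)

W² W³ W⁴ : ℕ → Leaper → Board
W² n L = image L rot90 (W¹ n L)
W³ n L = image L (rot90 ∘ rot90) (W¹ n L)
W⁴ n L = image L (rot90 ∘ rot90 ∘ rot90) (W¹ n L)

-- Depends on the presentation (p , q) of L, and is meant for q ≢ 0.
pinwheel : ℕ → Leaper → Board
pinwheel n L = W¹ n L ∪ W² n L ∪ W³ n L ∪ W⁴ n L

infixr 7 _*ᵥ_

_*ᵥ_ : ∀ {m n} → Vec (Vec ℕ n) m → Vec ℕ n → Vec ℕ m
A *ᵥ v = map (λ row → sum (zipWith ℕ._*_ row v)) A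

A-pinwheel : ℕ → Vec (Vec ℕ 2) 2
A-pinwheel n = (0 ∷ 1       ∷ [])
             ∷ (1 ∷ 2 ℕ.* n ∷ [])
             ∷ []

{-# OPTIONS --safe #-}
module Submission where

-- Why the board is dual.  The first arm of the board is a patch of the lattice
-- of points ½ (p + q , p - q) + 2 q (i , j), with (i , j) ranging over the
-- region 0 ≤ i + j ≤ n, 1 - n ≤ j - i ≤ n, and the other three arms are its
-- quarter turns.  So the squares of the board correspond to cells (c , i , j),
-- where c names one of the four arms.  Comparing coordinates modulo 2 q, and
-- using 0 ≤ p < q, one finds that a move of the (p + 2 m q , q)-leaper inside
-- the board, for m = 0 (which is L) or m = n (which is M), always joins
-- consecutive arms, and that it does so exactly when the cells are related by
--
--   (c , i , j)  to  (c + 1 , k , l)   with   i + l = m,   k = j or k = j - 1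
--
-- in one of the two directions: these are the lemmas leap⇒edge and edge⇒leap.
-- Everything else takes place in the graph on cells defined by this rule,
-- called cellGraph n m.
--
-- Isomorphism (cellGraph-isomorphic): an involution of the cells turns the rule
-- for m into the rule for n - m.  If n = 2 k + 1 it is
-- (c , i , j) ↦ (c , k - i , k + 1 - j), half a turn of every arm; if n = 2 k it
-- is (c , i , j) ↦ (- c , k - j , k - i), a reflection of every arm that
-- also reverses the cyclic order of the arms.
--
-- Connectedness (cellGraph-connected): it suffices to treat m = 0.  There
-- (c , i , j + 1) and (c , i , j) have the common neighbour (c + 1 , j , - i)
-- whenever ∣ i ∣ ≤ j, so every cell with ∣ i ∣ ≤ j can be lowered to one with
-- j = ∣ i ∣.  The cells (- k , k) and (k , k) of consecutive arms are adjacent,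
-- and (- k - 1 , k + 1) reaches (- k , k) through (k , k + 1) and (k , k) in
-- the next arm, so all of these reach (0 , 0); the cells (0 , 0) of the
-- four arms form a cycle.  A cell with j < ∣ i ∣ is adjacent to the cell
-- (- j , i) of the preceding arm, which is of the kind already treated.

open import Defs
open import Data.Empty using (⊥; ⊥-elim)
open import Data.Integer.Base as ℤ
  using (ℤ; +_; -[1+_]; 0ℤ; 1ℤ; ∣_∣; sign; _◃_; _+_; _-_; _*_; -_; _≤_; +≤+; -≤+)
open import Data.Integer.Divisibility.Signed using (divides; ∣⇒∣ᵤ)
import Data.Integer.Properties as ℤ
open import Algebra.Properties.AbelianGroup ℤ.+-0-abelianGroup
  using () renaming (∙-cancelʳ to +-cancelʳ; ∙-cancelˡ to +-cancelˡ)
open import Data.Integer.Tactic.RingSolver using (solve; solve-∀)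
open import Data.List.Base using ([]; _∷_)
open import Data.Nat.Base as ℕ using (ℕ; zero; suc; _<_; z≤n; z<s)
import Data.Nat.Divisibility as ℕ
import Data.Nat.DivMod as ℕ
import Data.Nat.Properties as ℕ
open import Data.Product.Base using (_×_; _,_; ∃; ∃₂; proj₁; proj₂)
open import Data.Sum.Base as Sum using (_⊎_; inj₁; inj₂)
open import Function.Base using (_on_; _∘_; id)
open import Function.Bundles using (Inverse; Equivalence; _⇔_; mk⇔)
import Function.Construct.Composition as Composition
import Function.Construct.Symmetry as Symmetry
open import Level using (0ℓ)
open import Relation.Binary.Bundles using (Setoid)
open import Relation.Binary.Construct.Closure.ReflexiveTransitive as Star
  using (Star; ε; _◅_; _◅◅_)
open import Relation.Binary.Construct.Closure.Symmetric as SymClosure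
  using (SymClosure; fwd; bwd)
import Relation.Binary.Construct.On as On
open import Relation.Binary.Core using (Rel)
open import Relation.Binary.PropositionalEquality
  using (_≡_; _≢_; refl; sym; trans; cong; cong₂; subst; subst₂; setoid)
open import Relation.Nullary.Negation using (¬_)
open import Relation.Unary using (Pred)

-- Isomorphisms of induced graphs

-- The graph that a relation R induces on the elements satisfying P.
-- A leaper graph is one of these by definition.
induced : {A : Set} → Pred A 0ℓ → Rel A 0ℓ → Graph
induced {A} P R = record
  { vertices = On.setoid (setoid A) (proj₁ {B = P})
  ; Adj      = R on proj₁
  }

isomorphic-trans : ∀ G H K → Isomorphic G H → Isomorphic H K → Isomorphic G K
isomorphic-trans _ _ _ (φ , φ-adj) (ψ , ψ-adj) =
  Composition.inverse φ ψ ,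
  λ u v → Composition.equivalence (φ-adj u v) (ψ-adj (Inverse.to φ u) (Inverse.to φ v))

connected-resp-isomorphic : ∀ {G H} → Isomorphic G H → Connected G → Connected H
connected-resp-isomorphic {G} {H} (φ , φ-adj) conn u v =
  inj₁ (H.sym (strictlyInverseˡ u)) ◅
  Star.gmap to (λ {x} {y} → Sum.map to-cong (Equivalence.to (φ-adj x y)))
    (conn (from u) (from v)) ◅◅
  inj₁ (strictlyInverseˡ v) ◅ ε
  where
  open Inverse φ
  module H = Setoid (Graph.vertices H)

module _ {A A′ : Set} {P : Pred A 0ℓ} {P′ : Pred A′ 0ℓ} {R : Rel A 0ℓ} {R′ : Rel A′ 0ℓ} where

  isomorphic-sym : Isomorphic (induced P R) (induced P′ R′) →
                   Isomorphic (induced P′ R′) (induced P R)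
  isomorphic-sym (φ , φ-adj) = Symmetry.inverse φ , λ u v →
    subst₂ (λ a b → R′ a b ⇔ R (proj₁ (from u)) (proj₁ (from v)))
      (strictlyInverseˡ u) (strictlyInverseˡ v)
      (Symmetry.equivalence (φ-adj (from u) (from v)))
    where open Inverse φ

  -- An injection that carries P onto P′ and matches R on P with R′ on P′.
  isomorphic-by :
    (f : A → A′) →
    (∀ {x} → P x → P′ (f x)) →
    (∀ {y} → P′ y → ∃ λ x → P x × f x ≡ y) →
    (∀ {x x′} → f x ≡ f x′ → x ≡ x′) →
    (∀ {x y} → P x → P y → R x y ⇔ R′ (f x) (f y)) →
    Isomorphic (induced P R) (induced P′ R′)
  isomorphic-by f f-mem f-surj f-inj f-adj = record
    { to        = λ (x , Px) → f x , f-mem Px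
    ; from      = λ (y , P′y) → preimage P′y
    ; to-cong   = cong f
    ; from-cong = λ {u} {v} u≈v →
        f-inj (trans (image≡ (proj₂ u)) (trans u≈v (sym (image≡ (proj₂ v)))))
    ; inverse   = (λ {u} x≈ → trans (cong f x≈) (image≡ (proj₂ u)))
                , (λ {u} {v} y≈ → f-inj (trans (image≡ (proj₂ v)) y≈))
    } , λ (x , Px) (y , Py) → f-adj Px Py
    where
    preimage : ∀ {y} → P′ y → ∃ P
    preimage P′y = let x , Px , _ = f-surj P′y in x , Px
    image≡ : ∀ {y} (P′y : P′ y) → f (proj₁ (preimage P′y)) ≡ y
    image≡ P′y = proj₂ (proj₂ (f-surj P′y))

-- Integer arithmetic

-- An inequality follows from another with the same difference of sides; with
-- the ring solver this replaces linear arithmetic.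
≤-by : ∀ {a b c d} → a ≤ b → b - a ≡ d - c → c ≤ d
≤-by a≤b eq = ℤ.0≤i-j⇒j≤i (subst (0ℤ ≤_) eq (ℤ.i≤j⇒0≤j-i a≤b))

odd≢0 : ∀ t → 1ℤ + + 2 * t ≢ 0ℤ
odd≢0 t eq = even≢1 ∣ t ∣ (trans (sym (ℤ.abs-* (+ 2) t)) (cong ∣_∣ 2t≡-1))
  where
  2t≡-1 : + 2 * t ≡ - 1ℤ
  2t≡-1 = trans (ring₁ t) (cong (_- 1ℤ) eq)
    where
    ring₁ : ∀ t → + 2 * t ≡ 1ℤ + + 2 * t - 1ℤ
    ring₁ = solve-∀
  even≢1 : ∀ k → 2 ℕ.* k ≢ 1
  even≢1 (suc k) eq = ℕ.m+1+n≢0 k (ℕ.suc-injective eq)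

∣2*∣ : ∀ z → ∣ + 2 * z ∣ ≡ 2 ℕ.* ∣ z ∣
∣2*∣ z = ℤ.abs-* (+ 2) z

±-of-abs : ∀ z {r} → ∣ z ∣ ≡ r → z ≡ + r ⊎ z ≡ - + r
±-of-abs (+ k)    refl = inj₁ refl
±-of-abs -[1+ k ] refl = inj₂ refl

±-of-double : ∀ {x r} z → x ≡ + 2 * z → ∣ x ∣ ≡ 2 ℕ.* r → z ≡ + r ⊎ z ≡ - + r
±-of-double z refl eq = ±-of-abs z (ℕ.*-cancelˡ-≡ _ _ 2 (trans (sym (∣2*∣ z)) eq))

±-of-double-neg : ∀ {x r} z → x ≡ + 2 * - z → ∣ x ∣ ≡ 2 ℕ.* r → z ≡ + r ⊎ z ≡ - + r
±-of-double-neg z eq ∣x∣≡ with ±-of-double (- z) eq ∣x∣≡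
... | inj₁ -z≡r  = inj₂ (trans (sym (ℤ.neg-involutive z)) (cong -_ -z≡r))
... | inj₂ -z≡-r = inj₁ (ℤ.neg-injective -z≡-r)

∣-<⇒≡0 : ∀ {m n} → n ℕ.∣ m → m < n → m ≡ 0
∣-<⇒≡0 {zero}  _     _     = refl
∣-<⇒≡0 {suc m} n∣1+m 1+m<n = ⊥-elim (ℕ.<⇒≱ 1+m<n (ℕ.∣⇒≤ n∣1+m))

double-complement : ∀ n m → n - (n - m) ≡ m
double-complement = solve-∀

parity : ∀ n → ∃ λ k → + n ≡ k + k ⊎ + n ≡ 1ℤ + (k + k)
parity zero = 0ℤ , inj₁ refl
parity (suc n) with parity n
... | k , inj₁ eq = k , inj₂ (cong ℤ.suc eq)
... | k , inj₂ eq = 1ℤ + k , inj₁ (trans (cong ℤ.suc eq) (regroup k))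
  where
  regroup : ∀ k → 1ℤ + (1ℤ + (k + k)) ≡ (1ℤ + k) + (1ℤ + k)
  regroup = solve-∀

≤-offset : ∀ {k j} → + k ≤ j → ∃ λ r → j ≡ + (r ℕ.+ k)
≤-offset {k} (+≤+ {n = m} k≤m) = m ℕ.∸ k , cong +_ (sym (ℕ.m∸n+n≡m k≤m))

abs-offset : ∀ i {j} → i ≤ j → - i ≤ j → ∃ λ r → j ≡ + (r ℕ.+ ∣ i ∣)
abs-offset (+ k)    i≤j _    = ≤-offset i≤j
abs-offset -[1+ k ] _   -i≤j = ≤-offset -i≤j

≤-abs : ∀ i r → i ≤ + (r ℕ.+ ∣ i ∣)
≤-abs (+ k)    r = +≤+ (ℕ.m≤n+m k r)
≤-abs -[1+ k ] r = -≤+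

neg≤-abs : ∀ i r → - i ≤ + (r ℕ.+ ∣ i ∣)
neg≤-abs i r = subst (λ k → - i ≤ + (r ℕ.+ k)) (ℤ.∣-i∣≡∣i∣ i) (≤-abs (- i) r)

-- Quarter turns

-- The arm of the pinwheel, as the number of quarter turns (0 to 3) from the
-- first arm; next is one more quarter turn counterclockwise, reflect is the
-- negation modulo 4.
data Quadrant : Set where
  I II III IV : Quadrant

next prev reflect : Quadrant → Quadrant
next I   = II
next II  = III
next III = IV
next IV  = I
prev I   = IV
prev II  = I
prev III = II
prev IV  = III
reflect I   = I
reflect II  = IV
reflect III = III
reflect IV  = II

next-prev : ∀ c → next (prev c) ≡ c
next-prev I   = refl
next-prev II  = refl
next-prev III = refl
next-prev IV  = refl

reflect-involutive : ∀ c → reflect (reflect c) ≡ c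
reflect-involutive I   = refl
reflect-involutive II  = refl
reflect-involutive III = refl
reflect-involutive IV  = refl

reflect-next : ∀ c → reflect c ≡ next (reflect (next c))
reflect-next I   = refl
reflect-next II  = refl
reflect-next III = refl
reflect-next IV  = refl

-- A relation invariant under a common quarter turn of both arms need only be
-- checked when the first of them is I.
rotation-induction : (R : Rel Quadrant 0ℓ) →
                     (∀ c d → R c d → R (next c) (next d)) →
                     (∀ d → R I d) → ∀ c d → R c d
rotation-induction R turn base = λ where
    I   → base
    II  → step base
    III → step (step base)
    IV  → step (step (step base))
  where
  step : ∀ {c} → (∀ d → R c d) → ∀ d → R (next c) d
  step {c} Rc d = subst (R (next c)) (next-prev d) (turn c (prev d) (Rc (prev d)))

rotate : Quadrant → ℤ × ℤ → ℤ × ℤ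
rotate I   = id
rotate II  = rot90
rotate III = rot90 ∘ rot90
rotate IV  = rot90 ∘ rot90 ∘ rot90

rotate-next : ∀ c v → rotate (next c) v ≡ rot90 (rotate c v)
rotate-next I   v = refl
rotate-next II  v = refl
rotate-next III v = refl
rotate-next IV  (x , y) = sym (cong₂ _,_ (ℤ.neg-involutive x) (ℤ.neg-involutive y))

rot90-injective : ∀ {u v} → rot90 u ≡ rot90 v → u ≡ v
rot90-injective eq = cong₂ _,_ (cong proj₂ eq) (ℤ.neg-injective (cong proj₁ eq))

infixl 6 _⊖_

_⊖_ : ℤ × ℤ → ℤ × ℤ → ℤ × ℤ
(x , y) ⊖ (x′ , y′) = x - x′ , y - y′

-- The vectors that are twice the displacement of a move of the (a , b)-leaper.
-- The factor 2 is there because centres are recorded with doubled coordinates.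
Leap : ℕ → ℕ → ℤ × ℤ → Set
Leap a b (x , y) = (∣ x ∣ ≡ 2 ℕ.* a × ∣ y ∣ ≡ 2 ℕ.* b)
                 ⊎ (∣ x ∣ ≡ 2 ℕ.* b × ∣ y ∣ ≡ 2 ℕ.* a)

module _ (a b : ℕ) where

  leap-rot90 : ∀ {u v} → Leap a b (u ⊖ v) → Leap a b (rot90 u ⊖ rot90 v)
  leap-rot90 {x , y} {x′ , y′} = Sum.swap ∘ Sum.map turn turn
    where
    turn : ∀ {k l} → ∣ x - x′ ∣ ≡ k × ∣ y - y′ ∣ ≡ l →
           ∣ - y - - y′ ∣ ≡ l × ∣ x - x′ ∣ ≡ k
    turn (eq , eq′) =
      trans (trans (cong ∣_∣ (sym (ℤ.neg-distrib-+ y (- y′)))) (ℤ.∣-i∣≡∣i∣ (y - y′))) eq′ , eq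

  leap-rot90⁻¹ : ∀ {u v} → Leap a b (rot90 u ⊖ rot90 v) → Leap a b (u ⊖ v)
  leap-rot90⁻¹ {x , y} {x′ , y′} = Sum.swap ∘ Sum.map turn turn
    where
    turn : ∀ {k l} → ∣ - y - - y′ ∣ ≡ k × ∣ x - x′ ∣ ≡ l →
           ∣ x - x′ ∣ ≡ l × ∣ y - y′ ∣ ≡ k
    turn (eq , eq′) = eq′ ,
      trans (sym (trans (cong ∣_∣ (sym (ℤ.neg-distrib-+ y (- y′)))) (ℤ.∣-i∣≡∣i∣ (y - y′)))) eq

  leap-sym : ∀ {u v} → Leap a b (u ⊖ v) → Leap a b (v ⊖ u)
  leap-sym {x , y} {x′ , y′} = Sum.map flip flip
    where
    flip : ∀ {k l} → ∣ x - x′ ∣ ≡ k × ∣ y - y′ ∣ ≡ l →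
           ∣ x′ - x ∣ ≡ k × ∣ y′ - y ∣ ≡ l
    flip (eq , eq′) = trans (ℤ.∣i-j∣≡∣j-i∣ x′ x) eq , trans (ℤ.∣i-j∣≡∣j-i∣ y′ y) eq′

-- The graph on cells and its duality

-- An arm together with lattice coordinates (i , j) in that arm, which turn with
-- the arm.
Cell : Set
Cell = Quadrant × ℤ × ℤ

-- The lattice coordinates of the squares of an arm.  The parameter n is an
-- integer so that the ring solver can treat it as a variable.
record Region (n i j : ℤ) : Set where
  field
    sum-lower  : 0ℤ ≤ i + j
    sum-upper  : i + j ≤ n
    diff-lower : 1ℤ - n ≤ j - i
    diff-upper : j - i ≤ n

open Region

Cells : ℤ → Pred Cell 0ℓ
Cells n (_ , i , j) = Region n i j

-- An adjacency of cells directed from an arm to the next one.  With m = 0 and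
-- m = n it describes the moves of L and M.
Step : ℤ → Rel Cell 0ℓ
Step m (c , i , j) (d , k , l) = d ≡ next c × i + l ≡ m × (k ≡ j ⊎ j ≡ 1ℤ + k)

-- The cells of order n, joined by steps for m in either direction.
cellGraph : ℤ → ℤ → Graph
cellGraph n m = induced (Cells n) (SymClosure (Step m))

-- Applied twice, the exchange of m and n - m is the identity, so for an
-- involution φ one implication between adjacencies yields the other.
module _ {n m : ℤ}
         (φ : Cell → Cell)
         (φ-involutive : ∀ x → φ (φ x) ≡ x)
         (φ-cells : ∀ {x} → Cells n x → Cells n (φ x))
         (φ-step : ∀ m {x y} → Step m x y → SymClosure (Step (n - m)) (φ x) (φ y)) where

  involution-isomorphic : Isomorphic (cellGraph n m) (cellGraph n (n - m))
  involution-isomorphic =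
    isomorphic-by {R = SymClosure (Step m)} {R′ = SymClosure (Step (n - m))}
      φ φ-cells (λ {y} Dy → φ y , φ-cells Dy , φ-involutive y)
      (λ {x} {y} eq → trans (sym (φ-involutive x)) (trans (cong φ eq) (φ-involutive y)))
      λ _ _ → mk⇔ (φ-edge m) λ e →
        subst₂ (SymClosure (Step m)) (φ-involutive _) (φ-involutive _)
          (subst (λ k → SymClosure (Step k) _ _) (double-complement n m) (φ-edge (n - m) e))
    where
    φ-edge : ∀ m {x y} → SymClosure (Step m) x y → SymClosure (Step (n - m)) (φ x) (φ y)
    φ-edge m (fwd s) = φ-step m s
    φ-edge m (bwd s) = SymClosure.symmetric _ (φ-step m s)

-- Each arm is turned by 180 degrees about its centre.
odd-isomorphic : ∀ k m → let n = 1ℤ + (k + k) in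
                 Isomorphic (cellGraph n m) (cellGraph n (n - m))
odd-isomorphic k m = involution-isomorphic φ
    (λ (c , i , j) → cong (c ,_)
      (cong₂ _,_ (double-complement k i) (double-complement (1ℤ + k) j)))
    region
    step
  where
  sums : ∀ k i l → (k - i) + (1ℤ + k - l) ≡ 1ℤ + (k + k) - (i + l)
  sums = solve-∀
  shift : ∀ k j → 1ℤ + k - j ≡ 1ℤ + (k - j)
  shift = solve-∀
  unshift : ∀ k j → k - j ≡ 1ℤ + k - (1ℤ + j)
  unshift = solve-∀
  region : ∀ {i j} → Region (1ℤ + (k + k)) i j → Region (1ℤ + (k + k)) (k - i) (1ℤ + k - j)
  region {i} {j} D = record
    { sum-lower  = ≤-by (sum-upper D)  (solve (i ∷ j ∷ k ∷ []))
    ; sum-upper  = ≤-by (sum-lower D)  (solve (i ∷ j ∷ k ∷ []))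
    ; diff-lower = ≤-by (diff-upper D) (solve (i ∷ j ∷ k ∷ []))
    ; diff-upper = ≤-by (diff-lower D) (solve (i ∷ j ∷ k ∷ []))
    }
  φ : Cell → Cell
  φ (c , i , j) = c , k - i , 1ℤ + k - j
  step : ∀ m {x y} → Step m x y → SymClosure (Step (1ℤ + (k + k) - m)) (φ x) (φ y)
  step _ {c , i , j} {_ , _ , l} (refl , refl , inj₁ refl) =
    fwd (refl , sums k i l , inj₂ (shift k j))
  step _ {c , i , _} {_ , k′ , l} (refl , refl , inj₂ refl) =
    fwd (refl , sums k i l , inj₁ (unshift k k′))

-- Each arm is reflected in its axis i + j = k, and steps are reversed:
-- a step between arms c and c + 1 becomes one from arm - c - 1 to arm - c.
even-isomorphic : ∀ k m → let n = k + k in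
                  Isomorphic (cellGraph n m) (cellGraph n (n - m))
even-isomorphic k m = involution-isomorphic φ
    (λ (c , i , j) → cong₂ _,_ (reflect-involutive c)
      (cong₂ _,_ (double-complement k i) (double-complement k j)))
    region
    step
  where
  sums : ∀ k i l → (k - l) + (k - i) ≡ k + k - (i + l)
  sums = solve-∀
  shift : ∀ k j → k - j ≡ 1ℤ + (k - (1ℤ + j))
  shift = solve-∀
  region : ∀ {i j} → Region (k + k) i j → Region (k + k) (k - j) (k - i)
  region {i} {j} D = record
    { sum-lower  = ≤-by (sum-upper D)  (solve (i ∷ j ∷ k ∷ []))
    ; sum-upper  = ≤-by (sum-lower D)  (solve (i ∷ j ∷ k ∷ []))
    ; diff-lower = ≤-by (diff-lower D) (solve (i ∷ j ∷ k ∷ []))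
    ; diff-upper = ≤-by (diff-upper D) (solve (i ∷ j ∷ k ∷ []))
    }
  φ : Cell → Cell
  φ (c , i , j) = reflect c , k - j , k - i
  step : ∀ m {x y} → Step m x y → SymClosure (Step (k + k - m)) (φ x) (φ y)
  step _ {c , i , j} {_ , _ , l} (refl , refl , inj₁ refl) =
    bwd (reflect-next c , sums k i l , inj₁ refl)
  step _ {c , i , _} {_ , k′ , l} (refl , refl , inj₂ refl) =
    bwd (reflect-next c , sums k i l , inj₂ (shift k k′))

cellGraph-isomorphic : ∀ n m → Isomorphic (cellGraph (+ n) m) (cellGraph (+ n) (+ n - m))
cellGraph-isomorphic n m with parity n
... | k , inj₁ n≡ rewrite n≡ = even-isomorphic k m
... | k , inj₂ n≡ rewrite n≡ = odd-isomorphic k m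

-- Connectedness of the graph on cells

module _ {n : ℤ} (1≤n : 1ℤ ≤ n) where

  private
    0≤n : 0ℤ ≤ n
    0≤n = ℤ.≤-trans (+≤+ z≤n) 1≤n

  origin-region : Region n 0ℤ 0ℤ
  origin-region = record
    { sum-lower  = ℤ.≤-refl
    ; sum-upper  = 0≤n
    ; diff-lower = ℤ.i≤j⇒i-j≤0 1≤n
    ; diff-upper = 0≤n
    }

  open Graph (cellGraph n 0ℤ) using (_≈_; Adj)

  -- Joined by a walk to the cell (0 , 0) of the first arm, whichever proof of
  -- membership the endpoint carries.
  Reachable : Cell → Set
  Reachable x = (Dx : Cells n x) →
                Star (λ u v → u ≈ v ⊎ Adj u v) ((I , 0ℤ , 0ℤ) , origin-region) (x , Dx)

  reachable-edge : ∀ {x y} → Cells n x → SymClosure (Step 0ℤ) x y → Reachable x → Reachable y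
  reachable-edge {x} {y} Dx e reach Dy = reach Dx ◅◅ _◅_ {j = y , Dy} (inj₂ e) ε

  reachable-hub : ∀ c → Reachable (c , 0ℤ , 0ℤ)
  reachable-hub = λ where
      I   → hub
      II  → spoke I hub
      III → spoke II (spoke I hub)
      IV  → spoke III (spoke II (spoke I hub))
    where
    hub : Reachable (I , 0ℤ , 0ℤ)
    hub D = _◅_ {j = _ , D} (inj₁ refl) ε
    spoke : ∀ c → Reachable (c , 0ℤ , 0ℤ) → Reachable (next c , 0ℤ , 0ℤ)
    spoke c = reachable-edge origin-region (fwd (refl , refl , inj₁ refl))

  turn-region : ∀ {i j} → j ≤ i → Region n i j → Region n (- j) i
  turn-region {i} {j} j≤i D = record
    { sum-lower  = ≤-by j≤i (solve (i ∷ j ∷ []))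
    ; sum-upper  = ≤-by (ℤ.+-mono-≤ (diff-lower D) (+≤+ (z≤n {1}))) (solve (i ∷ j ∷ n ∷ []))
    ; diff-lower = ≤-by (ℤ.+-mono-≤ 1≤n (sum-lower D)) (solve (i ∷ j ∷ n ∷ []))
    ; diff-upper = ≤-by (sum-upper D) (solve (i ∷ j ∷ n ∷ []))
    }

  reachable-turn : ∀ {c i j} → Region n (- j) i →
                   Reachable (c , - j , i) → Reachable (next c , i , j)
  reachable-turn {c} {i} {j} D = reachable-edge D (fwd (refl , ℤ.+-inverseˡ j , inj₁ refl))

  -- If (i , j + 1) lies in the region and ∣ i ∣ ≤ j, then so do (i , j) and the
  -- common neighbour (j , - i) of these two in the next arm.
  raise-region : ∀ {i j} → i ≤ j → 0ℤ ≤ i + j → Region n i (1ℤ + j) → Region n i j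
  raise-region {i} {j} i≤j 0≤i+j D = record
    { sum-lower  = 0≤i+j
    ; sum-upper  = ≤-by (ℤ.+-mono-≤ (sum-upper D) (+≤+ (z≤n {1}))) (solve (i ∷ j ∷ n ∷ []))
    ; diff-lower = ≤-by (ℤ.+-mono-≤ 1≤n i≤j) (solve (i ∷ j ∷ n ∷ []))
    ; diff-upper = ≤-by (ℤ.+-mono-≤ (diff-upper D) (+≤+ (z≤n {1}))) (solve (i ∷ j ∷ n ∷ []))
    }

  pivot-region : ∀ {i j} → i ≤ j → 0ℤ ≤ i + j → Region n i (1ℤ + j) → Region n j (- i)
  pivot-region {i} {j} i≤j 0≤i+j D = record
    { sum-lower  = ≤-by i≤j (solve (i ∷ j ∷ []))
    ; sum-upper  = ≤-by (ℤ.+-mono-≤ (diff-upper D) (+≤+ (z≤n {1}))) (solve (i ∷ j ∷ n ∷ []))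
    ; diff-lower = ≤-by (sum-upper D) (solve (i ∷ j ∷ n ∷ []))
    ; diff-upper = ≤-by (ℤ.+-mono-≤ 0≤i+j 0≤n) (solve (i ∷ j ∷ n ∷ []))
    }

  reachable-raise : ∀ {c i j} → i ≤ j → 0ℤ ≤ i + j → Region n i (1ℤ + j) →
                    Reachable (c , i , j) → Reachable (c , i , 1ℤ + j)
  reachable-raise {c} {i} {j} i≤j 0≤i+j D =
    reachable-edge (pivot-region i≤j 0≤i+j D) (bwd (refl , ℤ.+-inverseʳ i , inj₂ refl)) ∘
    reachable-edge (raise-region i≤j 0≤i+j D) (fwd (refl , ℤ.+-inverseʳ i , inj₁ refl))

  -- Two cells that precede (- k - 1 , k + 1) on a walk to it.
  antidiagonal-region : ∀ {k} → 0ℤ ≤ k → Region n (- (1ℤ + k)) (1ℤ + k) → Region n (- k) k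
  antidiagonal-region {k} 0≤k D = record
    { sum-lower  = ≤-by (ℤ.≤-refl {0ℤ}) (solve (k ∷ []))
    ; sum-upper  = ≤-by 0≤n (solve (k ∷ n ∷ []))
    ; diff-lower = ≤-by (ℤ.+-mono-≤ 1≤n (ℤ.+-mono-≤ 0≤k 0≤k)) (solve (k ∷ n ∷ []))
    ; diff-upper = ≤-by (ℤ.+-mono-≤ (diff-upper D) (+≤+ (z≤n {2}))) (solve (k ∷ n ∷ []))
    }

  diagonal-region : ∀ {k} → 0ℤ ≤ k → Region n (- (1ℤ + k)) (1ℤ + k) → Region n k (1ℤ + k)
  diagonal-region {k} 0≤k D = record
    { sum-lower  = ≤-by (ℤ.+-mono-≤ (+≤+ (z≤n {1})) (ℤ.+-mono-≤ 0≤k 0≤k)) (solve (k ∷ []))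
    ; sum-upper  = ≤-by (ℤ.+-mono-≤ (diff-upper D) (+≤+ (z≤n {1}))) (solve (k ∷ n ∷ []))
    ; diff-lower = ≤-by 0≤n (solve (k ∷ n ∷ []))
    ; diff-upper = ≤-by 1≤n (solve (k ∷ n ∷ []))
    }

  reachable-antidiagonal : ∀ c k → Reachable (c , - + k , + k)
  reachable-antidiagonal c zero        = reachable-hub c
  reachable-antidiagonal c (suc k) D =
    reachable-edge D₂ (bwd (refl , ℤ.+-inverseˡ (+ suc k) , inj₂ refl))
      (reachable-raise ℤ.≤-refl (+≤+ z≤n) D₂
        (reachable-turn D₁ (reachable-antidiagonal c k)))
      D
    where
    D₁ = antidiagonal-region {+ k} (+≤+ z≤n) D
    D₂ = diagonal-region {+ k} (+≤+ z≤n) D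

  reachable-diagonal : ∀ c i → Reachable (next c , i , + ∣ i ∣)
  reachable-diagonal c (+ k) D =
    reachable-turn (turn-region ℤ.≤-refl D) (reachable-antidiagonal c k) D
  reachable-diagonal c -[1+ k ] = reachable-antidiagonal (next c) (suc k)

  -- The height r + ∣ i ∣ runs through all j with ∣ i ∣ ≤ j.
  reachable-column : ∀ c i r → Reachable (next c , i , + (r ℕ.+ ∣ i ∣))
  reachable-column c i zero    = reachable-diagonal c i
  reachable-column c i (suc r) D =
    reachable-raise i≤j 0≤i+j D (reachable-column c i r) D
    where
    i≤j   = ≤-abs i r
    0≤i+j = subst (_≤ i + + (r ℕ.+ ∣ i ∣)) (ℤ.+-inverseʳ i) (ℤ.+-monoʳ-≤ i (neg≤-abs i r))

  reachable-upper : ∀ c {i j} → i ≤ j → - i ≤ j → Reachable (next c , i , j)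
  reachable-upper c {i} i≤j -i≤j with abs-offset i i≤j -i≤j
  ... | r , refl = reachable-column c i r

  reachable : ∀ x → Reachable x
  reachable (c , i , j) D =
    subst (λ c → Reachable (c , i , j)) (next-prev c) (in-next (prev c)) D
    where
    -i≤j : - i ≤ j
    -i≤j = ≤-by (sum-lower D) (solve (i ∷ j ∷ []))
    in-next : ∀ c → Reachable (next c , i , j)
    in-next c with ℤ.≤-total i j
    ... | inj₁ i≤j = reachable-upper c i≤j -i≤j
    ... | inj₂ j≤i =
      reachable-turn {c} {i} {j} (turn-region j≤i D)
        (subst (λ c → Reachable (c , - j , i)) (next-prev c)
          (reachable-upper (prev c) {i = - j} {j = i}
            (≤-by (sum-lower D) (solve (i ∷ j ∷ [])))
            (≤-by j≤i (solve (i ∷ j ∷ [])))))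

  cellGraph-connected : Connected (cellGraph n 0ℤ)
  cellGraph-connected (x , Dx) (y , Dy) =
    Star.reverse (Sum.map sym (SymClosure.symmetric _)) (reachable x Dx) ◅◅ reachable y Dy

-- Moves in terms of centres

coordinate-move : ∀ e x x′ r →
  (∃ λ s → x′ ≡ x + (s ◃ r)) ⇔ ∣ (+ 2 * x′ + e) - (+ 2 * x + e) ∣ ≡ 2 ℕ.* r
coordinate-move e x x′ r = mk⇔ to from
  where
  double : ∀ e x x′ → (+ 2 * x′ + e) - (+ 2 * x + e) ≡ + 2 * (x′ - x)
  double = solve-∀
  cancel : ∀ x d → (x + d) - x ≡ d
  cancel = solve-∀
  uncancel : ∀ x x′ → x′ ≡ x + (x′ - x)
  uncancel = solve-∀
  ∣double∣ : ∀ x′ → ∣ (+ 2 * x′ + e) - (+ 2 * x + e) ∣ ≡ 2 ℕ.* ∣ x′ - x ∣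
  ∣double∣ x′ = trans (cong ∣_∣ (double e x x′)) (∣2*∣ (x′ - x))
  to : (∃ λ s → x′ ≡ x + (s ◃ r)) → ∣ (+ 2 * x′ + e) - (+ 2 * x + e) ∣ ≡ 2 ℕ.* r
  to (s , refl) = trans (∣double∣ (x + (s ◃ r)))
    (cong (2 ℕ.*_) (trans (cong ∣_∣ (cancel x (s ◃ r))) (ℤ.abs-◃ s r)))
  from : ∣ (+ 2 * x′ + e) - (+ 2 * x + e) ∣ ≡ 2 ℕ.* r → ∃ λ s → x′ ≡ x + (s ◃ r)
  from eq = sign d , trans (uncancel x x′)
    (cong (λ z → x + z) (trans (sym (ℤ.◃-inverse d)) (cong (sign d ◃_) ∣d∣≡r)))
    where
    d = x′ - x
    ∣d∣≡r : ∣ d ∣ ≡ r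
    ∣d∣≡r = ℕ.*-cancelˡ-≡ _ _ 2 (trans (sym (∣double∣ x′)) eq)

module _ (L : Leaper) where

  move⇔leap : ∀ K a b → Move K a b ⇔ Leap (p K) (q K) (centre L b ⊖ centre L a)
  move⇔leap K (x , y) (x′ , y′) = mk⇔ to from
    where
    e = + ((p L ℕ.+ q L) ℕ.% 2)
    module X r = Equivalence (coordinate-move e x x′ r)
    module Y r = Equivalence (coordinate-move e y y′ r)
    to : Move K (x , y) (x′ , y′) → Leap (p K) (q K) (centre L (x′ , y′) ⊖ centre L (x , y))
    to (s , t , inj₁ eq) = inj₁ (X.to (p K) (s , cong proj₁ eq) , Y.to (q K) (t , cong proj₂ eq))
    to (s , t , inj₂ eq) = inj₂ (X.to (q K) (s , cong proj₁ eq) , Y.to (p K) (t , cong proj₂ eq))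
    from : Leap (p K) (q K) (centre L (x′ , y′) ⊖ centre L (x , y)) → Move K (x , y) (x′ , y′)
    from (inj₁ (X≡ , Y≡)) =
      let s , x≡ = X.from (p K) X≡
          t , y≡ = Y.from (q K) Y≡
      in s , t , inj₁ (cong₂ _,_ x≡ y≡)
    from (inj₂ (X≡ , Y≡)) =
      let s , x≡ = X.from (q K) X≡
          t , y≡ = Y.from (p K) Y≡
      in s , t , inj₂ (cong₂ _,_ x≡ y≡)

  centre-injective : ∀ {a b} → centre L a ≡ centre L b → a ≡ b
  centre-injective eq = cong₂ _,_ (coordinate (cong proj₁ eq)) (coordinate (cong proj₂ eq))
    where
    coordinate : ∀ {x x′ e} → + 2 * x + e ≡ + 2 * x′ + e → x ≡ x′
    coordinate eq = ℤ.*-cancelˡ-≡ (+ 2) _ _ (+-cancelʳ _ _ _ eq)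

edge-next : ∀ {m c d i j k l} → SymClosure (Step m) (c , i , j) (d , k , l) →
            SymClosure (Step m) (next c , i , j) (next d , k , l)
edge-next (fwd (eq , step)) = fwd (cong next eq , step)
edge-next (bwd (eq , step)) = bwd (cong next eq , step)

-- For p = 0 the displacements of M to the next arm come with both signs,
-- giving i + l = n or i + l = - n; the shape of the region excludes the latter.
antipodal-free : ∀ {n i j k l} → Region n i j → Region n k l → i + l ≢ - n
antipodal-free {n} {i} {j} {k} {l} D E i+l≡-n = ℤ.<⇒≱ (ℤ.+<+ (z<s {0})) 1≤0
  where
  1≤0 : 1ℤ ≤ 0ℤ
  1≤0 = ≤-by
    (ℤ.+-mono-≤ (ℤ.+-mono-≤ (sum-lower D) (diff-upper D))
                (ℤ.+-mono-≤ (sum-lower E) (diff-lower E)))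
    (trans (collect n i j k l) (trans (cong (λ z → + 2 * (z + n) - 1ℤ) i+l≡-n) (close n)))
    where
    collect : ∀ n i j k l → (i + j + n + (k + l + (l - k))) - (0ℤ + (j - i) + (0ℤ + (1ℤ - n)))
                          ≡ + 2 * (i + l + n) - 1ℤ
    collect = solve-∀
    close : ∀ n → + 2 * (- n + n) - 1ℤ ≡ 0ℤ - 1ℤ
    close = solve-∀

-- Squares and cells

module Pinwheel (L : Leaper) (p<q : p L < q L) where

  private
    -- h and e are the quotient and the remainder of p + q by 2; e is also the
    -- offset used by centre.
    P Q e h : ℤ
    P = + p L
    Q = + q L
    e = + ((p L ℕ.+ q L) ℕ.% 2)
    h = + ((p L ℕ.+ q L) ℕ./ 2)

    0<q : 0 < q L
    0<q = ℕ.≤-<-trans z≤n p<q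

    0<4Q : 0ℤ ℤ.< + 4 * Q
    0<4Q = subst (0ℤ ℤ.<_) (ℤ.pos-* 4 (q L))
      (ℤ.+<+ (ℕ.<-≤-trans 0<q (ℕ.m≤m+n (q L) (3 ℕ.* q L))))

    instance
      q-nonZero : ℕ.NonZero (q L)
      q-nonZero = ℕ.>-nonZero 0<q

      4Q-nonZero : ℤ.NonZero (+ 4 * Q)
      4Q-nonZero = ℤ.i*j≢0 (+ 4) Q

      4Q-positive : ℤ.Positive (+ 4 * Q)
      4Q-positive = ℤ.positive 0<4Q

      4Q-nonNegative : ℤ.NonNegative (+ 4 * Q)
      4Q-nonNegative = ℤ.nonNegative (ℤ.<⇒≤ 0<4Q)

  P+Q≡2h+e : P + Q ≡ + 2 * h + e
  P+Q≡2h+e = trans (cong +_ (ℕ.m≡m%n+[m/n]*n (p L ℕ.+ q L) 2))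
    (trans (cong (λ z → e + z) (ℤ.pos-* ((p L ℕ.+ q L) ℕ./ 2) 2)) (swap e h))
    where
    swap : ∀ e h → e + h * + 2 ≡ + 2 * h + e
    swap = solve-∀

  -- The doubled coordinates of the lattice point of a cell.
  position : Cell → ℤ × ℤ
  position (c , i , j) = rotate c (P + Q + + 4 * Q * i , P - Q + + 4 * Q * j)

  -- The quarter turn about the origin, on squares instead of their centres; the
  -- shift by e appears when the origin is a vertex of the square (0 , 0).
  turn : Square → Square
  turn (a , b) = - b - e , a

  centre-turn : ∀ s → centre L (turn s) ≡ rot90 (centre L s)
  centre-turn (a , b) = cong (_, + 2 * a + e) (negate b e)
    where
    negate : ∀ b e → + 2 * (- b - e) + e ≡ - (+ 2 * b + e)
    negate = solve-∀

  turns : Quadrant → Square → Square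
  turns I   = id
  turns II  = turn
  turns III = turn ∘ turn
  turns IV  = turn ∘ turn ∘ turn

  centre-turns : ∀ c s → centre L (turns c s) ≡ rotate c (centre L s)
  centre-turns I   s = refl
  centre-turns II  s = centre-turn s
  centre-turns III s = trans (centre-turn (turn s)) (cong rot90 (centre-turn s))
  centre-turns IV  s =
    trans (centre-turn (turn (turn s))) (cong rot90 (centre-turns III s))

  -- The square whose centre, in doubled coordinates, is the position of the cell.
  square : Cell → Square
  square (c , i , j) = turns c (h + + 2 * Q * i , h - Q + + 2 * Q * j)

  centre-square : ∀ x → centre L (square x) ≡ position x
  centre-square (c , i , j) = trans (centre-turns c _) (cong (rotate c) base)
    where
    base₁ : ∀ h e Q i → + 2 * (h + + 2 * Q * i) + e ≡ + 2 * h + e + + 4 * Q * i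
    base₁ = solve-∀
    base₂ : ∀ h e Q j → + 2 * (h - Q + + 2 * Q * j) + e ≡ (+ 2 * h + e) - + 2 * Q + + 4 * Q * j
    base₂ = solve-∀
    base₃ : ∀ P Q j → P + Q - + 2 * Q + + 4 * Q * j ≡ P - Q + + 4 * Q * j
    base₃ = solve-∀
    base : centre L (square (I , i , j)) ≡ position (I , i , j)
    base = cong₂ _,_
      (trans (base₁ h e Q i) (cong (λ z → z + + 4 * Q * i) (sym P+Q≡2h+e)))
      (trans (base₂ h e Q j)
        (trans (cong (λ z → z - + 2 * Q + + 4 * Q * j) (sym P+Q≡2h+e)) (base₃ P Q j)))

  position-next : ∀ c i j → position (next c , i , j) ≡ rot90 (position (c , i , j))
  position-next c i j = rotate-next c (P + Q + + 4 * Q * i , P - Q + + 4 * Q * j)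

  -- Displacements between cells

  -- The displacement from a cell of arm I to one of arm I, II or III.  Halved
  -- and up to sign, each coordinate is Q s or P + Q s, and the parity of s
  -- depends only on the arms.

  Δx-I : ∀ P Q i k → (P + Q + + 4 * Q * k) - (P + Q + + 4 * Q * i) ≡ + 2 * (Q * (+ 2 * (k - i)))
  Δx-I = solve-∀

  Δy-I : ∀ P Q j l → (P - Q + + 4 * Q * l) - (P - Q + + 4 * Q * j) ≡ + 2 * (Q * (+ 2 * (l - j)))
  Δy-I = solve-∀

  Δx-II : ∀ P Q i l → - (P - Q + + 4 * Q * l) - (P + Q + + 4 * Q * i)
                    ≡ + 2 * - (P + Q * (+ 2 * (i + l)))
  Δx-II = solve-∀

  Δy-II : ∀ P Q j k → (P + Q + + 4 * Q * k) - (P - Q + + 4 * Q * j)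
                    ≡ + 2 * (Q * (1ℤ + + 2 * (k - j)))
  Δy-II = solve-∀

  Δx-III : ∀ P Q i k → - (P + Q + + 4 * Q * k) - (P + Q + + 4 * Q * i)
                     ≡ + 2 * - (P + Q * (1ℤ + + 2 * (i + k)))
  Δx-III = solve-∀

  Δy-III : ∀ P Q j l → - (P - Q + + 4 * Q * l) - (P - Q + + 4 * Q * j)
                     ≡ + 2 * - (P + Q * (1ℤ + + 2 * (j + l - 1ℤ)))
  Δy-III = solve-∀

  leap-next : ∀ a b d c k l i j →
              Leap a b (position (d , k , l) ⊖ position (c , i , j)) →
              Leap a b (position (next d , k , l) ⊖ position (next c , i , j))
  leap-next a b d c k l i j leap =
    subst₂ (λ u v → Leap a b (u ⊖ v)) (sym (position-next d k l)) (sym (position-next c i j))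
      (leap-rot90 a b {u = position (d , k , l)} {v = position (c , i , j)} leap)

  leap-next⁻¹ : ∀ a b d c k l i j →
                Leap a b (position (next d , k , l) ⊖ position (next c , i , j)) →
                Leap a b (position (d , k , l) ⊖ position (c , i , j))
  leap-next⁻¹ a b d c k l i j leap =
    leap-rot90⁻¹ a b {u = position (d , k , l)} {v = position (c , i , j)}
      (subst₂ (λ u v → Leap a b (u ⊖ v)) (position-next d k l) (position-next c i j) leap)

  -- Arithmetic modulo q

  -- Since 0 ≤ p < q, the only multiple of q among the possible p is 0.
  vanish : ∀ {s} → P + Q * s ≡ 0ℤ → p L ≡ 0 × s ≡ 0ℤ
  vanish {s} eq = p≡0 , ℤ.*-cancelˡ-≡ Q s 0ℤ
    (trans (sym (ℤ.+-identityˡ (Q * s)))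
      (trans (subst (λ k → + k + Q * s ≡ 0ℤ) p≡0 eq) (sym (ℤ.*-zeroʳ Q))))
    where
    quotient : ∀ P Q s → P ≡ (P + Q * s) + - s * Q
    quotient = solve-∀
    q∣p : q L ℕ.∣ p L
    q∣p = ∣⇒∣ᵤ (divides (- s)
      (trans (quotient P Q s) (trans (cong (λ z → z + - s * Q) eq) (ℤ.+-identityˡ (- s * Q)))))
    p≡0 : p L ≡ 0
    p≡0 = ∣-<⇒≡0 q∣p p<q

  odd-vanish : ∀ t → P + Q * (1ℤ + + 2 * t) ≢ 0ℤ
  odd-vanish t eq = odd≢0 t (proj₂ (vanish eq))

  position-injective : ∀ {x y} → position x ≡ position y → x ≡ y
  position-injective {c , _} {d , _} = rotation-induction
      (λ c d → ∀ {i j k l} → position (c , i , j) ≡ position (d , k , l) →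
               (c , i , j) ≡ (d , k , l))
      (λ c d ih {i} {j} {k} {l} eq → cong (λ (c , v) → next c , v)
        (ih (rot90-injective (trans (sym (position-next c i j)) (trans eq (position-next d k l))))))
      from-I c d
    where
    halve-zero : ∀ {x y z} → x ≡ y → y - x ≡ + 2 * z → z ≡ 0ℤ
    halve-zero {x} {z = z} refl Δ≡ = ℤ.*-cancelˡ-≡ (+ 2) z 0ℤ (trans (sym Δ≡) (ℤ.+-inverseʳ x))
    apart-II : ∀ {i j k l} → position (I , i , j) ≢ position (II , k , l)
    apart-II {j = j} {k} eq = odd≢0 (k - j)
      (ℤ.*-cancelˡ-≡ Q (1ℤ + + 2 * (k - j)) 0ℤ
        (trans (halve-zero (cong proj₂ eq) (Δy-II P Q j k)) (sym (ℤ.*-zeroʳ Q))))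
    from-I : ∀ d {i j k l} → position (I , i , j) ≡ position (d , k , l) → (I , i , j) ≡ (d , k , l)
    from-I I {i} {j} {k} {l} eq = cong (I ,_) (cong₂ _,_
      (ℤ.*-cancelˡ-≡ (+ 4 * Q) i k (+-cancelˡ (P + Q) _ _ (cong proj₁ eq)))
      (ℤ.*-cancelˡ-≡ (+ 4 * Q) j l (+-cancelˡ (P - Q) _ _ (cong proj₂ eq))))
    from-I II eq = ⊥-elim (apart-II eq)
    from-I III {i} {j} {k} {l} eq = ⊥-elim (odd-vanish (i + k)
      (ℤ.neg-injective (halve-zero (cong proj₁ eq) (Δx-III P Q i k))))
    from-I IV {i} {j} {k} {l} eq =
      ⊥-elim (apart-II (trans (position-next IV k l)
        (trans (cong rot90 (sym eq)) (sym (position-next I i j)))))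

  square-injective : ∀ {x y} → square x ≡ square y → x ≡ y
  square-injective {x} {y} eq = position-injective
    (trans (sym (centre-square x)) (trans (cong (centre L) eq) (centre-square y)))

  -- The lemmas whose names begin with ±q and ±A treat a halved coordinate that
  -- equals plus or minus that number; even and odd refer to the parity of its
  -- coefficient of Q, and multiple says that it has no term P.
  ±q-even : ∀ v → P + Q * (+ 2 * v) ≡ Q ⊎ P + Q * (+ 2 * v) ≡ - Q → ⊥
  ±q-even v (inj₁ eq) = odd-vanish (v - 1ℤ)
    (trans (ring₁ P Q v) (trans (cong (_- Q) eq) (ℤ.+-inverseʳ Q)))
    where
    ring₁ : ∀ P Q v → P + Q * (1ℤ + + 2 * (v - 1ℤ)) ≡ P + Q * (+ 2 * v) - Q
    ring₁ = solve-∀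
  ±q-even v (inj₂ eq) = odd-vanish v
    (trans (ring₁ P Q v) (trans (cong (λ z → z + Q) eq) (ℤ.+-inverseˡ Q)))
    where
    ring₁ : ∀ P Q v → P + Q * (1ℤ + + 2 * v) ≡ P + Q * (+ 2 * v) + Q
    ring₁ = solve-∀

  ±q-odd : ∀ t → P + Q * (1ℤ + + 2 * t) ≡ Q ⊎ P + Q * (1ℤ + + 2 * t) ≡ - Q → p L ≡ 0
  ±q-odd t (inj₁ eq) = proj₁ (vanish {+ 2 * t}
    (trans (ring₁ P Q t) (trans (cong (_- Q) eq) (ℤ.+-inverseʳ Q))))
    where
    ring₁ : ∀ P Q t → P + Q * (+ 2 * t) ≡ P + Q * (1ℤ + + 2 * t) - Q
    ring₁ = solve-∀
  ±q-odd t (inj₂ eq) = proj₁ (vanish {+ 2 * (1ℤ + t)}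
    (trans (ring₁ P Q t) (trans (cong (λ z → z + Q) eq) (ℤ.+-inverseˡ Q))))
    where
    ring₁ : ∀ P Q t → P + Q * (+ 2 * (1ℤ + t)) ≡ P + Q * (1ℤ + + 2 * t) + Q
    ring₁ = solve-∀

  ±q-multiple : ∀ s → Q * s ≡ Q ⊎ Q * s ≡ - Q → s ≡ 1ℤ ⊎ s ≡ - 1ℤ
  ±q-multiple s = Sum.map
    (λ eq → ℤ.*-cancelˡ-≡ Q s 1ℤ (trans eq (one Q)))
    (λ eq → ℤ.*-cancelˡ-≡ Q s (- 1ℤ) (trans eq (minus-one Q)))
    where
    one : ∀ Q → Q ≡ Q * 1ℤ
    one = solve-∀
    minus-one : ∀ Q → - Q ≡ Q * - 1ℤ
    minus-one = solve-∀

  ±q-even-multiple : ∀ t → Q * (+ 2 * t) ≡ Q ⊎ Q * (+ 2 * t) ≡ - Q → ⊥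
  ±q-even-multiple t eq with ±q-multiple (+ 2 * t) eq
  ... | inj₁ 2t≡1  = odd≢0 (- t) (trans (ring₁ t) (cong (λ z → 1ℤ - z) 2t≡1))
    where
    ring₁ : ∀ t → 1ℤ + + 2 * - t ≡ 1ℤ - + 2 * t
    ring₁ = solve-∀
  ... | inj₂ 2t≡-1 = odd≢0 t (cong ℤ.suc 2t≡-1)

  ±q-odd-multiple : ∀ j k → let z = Q * (1ℤ + + 2 * (k - j)) in
                    z ≡ Q ⊎ z ≡ - Q → k ≡ j ⊎ j ≡ 1ℤ + k
  ±q-odd-multiple j k = Sum.map
      (λ eq → ℤ.*-cancelˡ-≡ (+ 2) k j (trans (ring₁ j k)
        (trans (cong (λ z → z + (+ 2 * j - 1ℤ)) eq) (ring₂ j))))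
      (λ eq → sym (ℤ.*-cancelˡ-≡ (+ 2) (1ℤ + k) j (trans (ring₃ j k)
        (trans (cong (λ z → z + (+ 2 * j + 1ℤ)) eq) (ring₄ j)))))
    ∘ ±q-multiple (1ℤ + + 2 * (k - j))
    where
    ring₁ : ∀ j k → + 2 * k ≡ 1ℤ + + 2 * (k - j) + (+ 2 * j - 1ℤ)
    ring₁ = solve-∀
    ring₂ : ∀ j → 1ℤ + (+ 2 * j - 1ℤ) ≡ + 2 * j
    ring₂ = solve-∀
    ring₃ : ∀ j k → + 2 * (1ℤ + k) ≡ 1ℤ + + 2 * (k - j) + (+ 2 * j + 1ℤ)
    ring₃ = solve-∀
    ring₄ : ∀ j → - 1ℤ + (+ 2 * j + 1ℤ) ≡ + 2 * j
    ring₄ = solve-∀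

  -- Moves of the (p + 2 m q , q)-leaper, where A stands for p + 2 m q

  module _ {A : ℕ} {n m : ℤ} (A≡ : + A ≡ P + Q * (+ 2 * m)) (m≡0∨n : m ≡ 0ℤ ⊎ m ≡ n) where

    private
      positive : ∀ {s} → P + Q * s ≡ + A → s ≡ + 2 * m
      positive {s} eq = ℤ.*-cancelˡ-≡ Q s (+ 2 * m) (+-cancelˡ P _ _ (trans eq A≡))
      negative : ∀ {s} → P + Q * s ≡ - + A → P + (P + Q * (s + + 2 * m)) ≡ 0ℤ
      negative {s} eq = trans (ring₁ P Q s m)
        (trans (cong₂ _+_ eq (sym A≡)) (ℤ.+-inverseˡ (+ A)))
        where
        ring₁ : ∀ P Q s m → P + (P + Q * (s + + 2 * m)) ≡ P + Q * s + (P + Q * (+ 2 * m))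
        ring₁ = solve-∀

    ±A-even : ∀ v → P + Q * (+ 2 * v) ≡ + A ⊎ P + Q * (+ 2 * v) ≡ - + A → v ≡ m ⊎ v ≡ - m
    ±A-even v (inj₁ eq) = inj₁ (ℤ.*-cancelˡ-≡ (+ 2) v m (positive eq))
    ±A-even v (inj₂ eq) = inj₂ (trans (ring₁ v m)
      (trans (cong (_- m) (proj₂ (vanish (ℤ.*-cancelˡ-≡ (+ 2) _ 0ℤ
        (trans (ring₂ P Q v m) (negative eq)))))) (ℤ.+-identityˡ (- m))))
      where
      ring₁ : ∀ v m → v ≡ v + m - m
      ring₁ = solve-∀
      ring₂ : ∀ P Q v m → + 2 * (P + Q * (v + m)) ≡ P + (P + Q * (+ 2 * v + + 2 * m))
      ring₂ = solve-∀

    ±A-odd : p L ≡ 0 → ∀ t → P + Q * (1ℤ + + 2 * t) ≡ + A ⊎ P + Q * (1ℤ + + 2 * t) ≡ - + A → ⊥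
    ±A-odd _   t (inj₁ eq) = odd≢0 (t - m) (trans (ring₁ t m)
      (trans (cong (_- + 2 * m) (positive eq)) (ℤ.+-inverseʳ (+ 2 * m))))
      where
      ring₁ : ∀ t m → 1ℤ + + 2 * (t - m) ≡ 1ℤ + + 2 * t - + 2 * m
      ring₁ = solve-∀
    ±A-odd p≡0 t (inj₂ eq) = odd-vanish (t + m) (trans (ring₁ P Q t m)
      (cong₂ _-_ (negative eq) (cong +_ p≡0)))
      where
      ring₁ : ∀ P Q t m → P + Q * (1ℤ + + 2 * (t + m)) ≡ P + (P + Q * (1ℤ + + 2 * t + + 2 * m)) - P
      ring₁ = solve-∀

    private
      exclude : ∀ {i j k l} → Region n i j → Region n k l → i + l ≡ - m → i + l ≡ m
      exclude {i} {l = l} D E i+l≡-m = Sum.[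
          (λ m≡0 → subst (λ m → i + l ≡ - m → i + l ≡ m) (sym m≡0) id i+l≡-m) ,
          (λ m≡n → ⊥-elim (antipodal-free D E (trans i+l≡-m (cong -_ m≡n))))
        ]′ m≡0∨n

    -- The horizontal coordinate must be the one of size A, and this forces
    -- i + l = ± m.
    leap⇒step-I-II : ∀ {i j k l} → Region n i j → Region n k l →
                     Leap A (q L) (position (II , k , l) ⊖ position (I , i , j)) →
                     Step m (I , i , j) (II , k , l)
    leap⇒step-I-II {i} {j} {k} {l} D E (inj₁ (X≡ , Y≡)) =
      refl ,
      Sum.[ id , exclude D E ]′ (±A-even (i + l) (±-of-double-neg _ (Δx-II P Q i l) X≡)) ,
      ±q-odd-multiple j k (±-of-double _ (Δy-II P Q j k) Y≡)
    leap⇒step-I-II {i} {j} {k} {l} _ _ (inj₂ (X≡ , _)) =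
      ⊥-elim (±q-even (i + l) (±-of-double-neg _ (Δx-II P Q i l) X≡))

    leap⇒edge-from-I : ∀ d {i j k l} → Region n i j → Region n k l →
                       Leap A (q L) (position (d , k , l) ⊖ position (I , i , j)) →
                       SymClosure (Step m) (I , i , j) (d , k , l)
    leap⇒edge-from-I I {i} {j} {k} {l} _ _ (inj₁ (_ , Y≡)) =
      ⊥-elim (±q-even-multiple (l - j) (±-of-double _ (Δy-I P Q j l) Y≡))
    leap⇒edge-from-I I {i} {j} {k} {l} _ _ (inj₂ (X≡ , _)) =
      ⊥-elim (±q-even-multiple (k - i) (±-of-double _ (Δx-I P Q i k) X≡))
    leap⇒edge-from-I II D E leap = fwd (leap⇒step-I-II D E leap)
    -- Between opposite arms one coordinate forces p = 0, and then the other one is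
    -- an odd multiple of q, whereas A = 2 m q is an even one.
    leap⇒edge-from-I III {i} {j} {k} {l} _ _ (inj₁ (X≡ , Y≡)) =
      ⊥-elim (±A-odd (±q-odd (j + l - 1ℤ) (±-of-double-neg _ (Δy-III P Q j l) Y≡))
        (i + k) (±-of-double-neg _ (Δx-III P Q i k) X≡))
    leap⇒edge-from-I III {i} {j} {k} {l} _ _ (inj₂ (X≡ , Y≡)) =
      ⊥-elim (±A-odd (±q-odd (i + k) (±-of-double-neg _ (Δx-III P Q i k) X≡))
        (j + l - 1ℤ) (±-of-double-neg _ (Δy-III P Q j l) Y≡))
    -- A quarter turn takes the arms IV and I to I and II.
    leap⇒edge-from-I IV {i} {j} {k} {l} D E leap = bwd (refl , proj₂ step)
      where
      step : Step m (I , k , l) (II , i , j)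
      step = leap⇒step-I-II E D
        (leap-next A (q L) I IV i j k l
          (leap-sym A (q L) {u = position (IV , k , l)} {v = position (I , i , j)} leap))

    leap⇒edge : ∀ c d {i j k l} → Region n i j → Region n k l →
                Leap A (q L) (position (d , k , l) ⊖ position (c , i , j)) →
                SymClosure (Step m) (c , i , j) (d , k , l)
    leap⇒edge = rotation-induction
      (λ c d → ∀ {i j k l} → Region n i j → Region n k l →
               Leap A (q L) (position (d , k , l) ⊖ position (c , i , j)) →
               SymClosure (Step m) (c , i , j) (d , k , l))
      (λ c d ih {i} {j} {k} {l} D E leap →
        edge-next (ih D E (leap-next⁻¹ A (q L) d c k l i j leap)))
      leap⇒edge-from-I

    step⇒leap : ∀ x y → Step m x y → Leap A (q L) (position y ⊖ position x)
    step⇒leap (c , i , j) (_ , k , l) (refl , i+l≡m , near) = from c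
      where
      ∣Δx∣ : ∣ - (P - Q + + 4 * Q * l) - (P + Q + + 4 * Q * i) ∣ ≡ 2 ℕ.* A
      ∣Δx∣ = trans (cong ∣_∣ (trans (Δx-II P Q i l)
               (cong (λ z → + 2 * - z) (trans (cong (λ v → P + Q * (+ 2 * v)) i+l≡m) (sym A≡)))))
             (trans (∣2*∣ (- + A)) (cong (2 ℕ.*_) (ℤ.∣-i∣≡∣i∣ (+ A))))
      ∣Δy∣ : k ≡ j ⊎ j ≡ 1ℤ + k → ∣ (P + Q + + 4 * Q * k) - (P - Q + + 4 * Q * j) ∣ ≡ 2 ℕ.* q L
      ∣Δy∣ (inj₁ refl) = trans (cong ∣_∣ (ring₁ P Q k)) (∣2*∣ Q)
        where
        ring₁ : ∀ P Q k → (P + Q + + 4 * Q * k) - (P - Q + + 4 * Q * k) ≡ + 2 * Q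
        ring₁ = solve-∀
      ∣Δy∣ (inj₂ refl) = trans (cong ∣_∣ (ring₁ P Q k))
        (trans (∣2*∣ (- Q)) (cong (2 ℕ.*_) (ℤ.∣-i∣≡∣i∣ Q)))
        where
        ring₁ : ∀ P Q k → (P + Q + + 4 * Q * k) - (P - Q + + 4 * Q * (1ℤ + k)) ≡ + 2 * - Q
        ring₁ = solve-∀
      from : ∀ c → Leap A (q L) (position (next c , k , l) ⊖ position (c , i , j))
      from = λ where
          I   → from-I
          II  → from-II
          III → leap-next A (q L) III II k l i j from-II
          IV  → leap-next A (q L) IV III k l i j (leap-next A (q L) III II k l i j from-II)
        where
        from-I  = inj₁ (∣Δx∣ , ∣Δy∣ near)
        from-II = leap-next A (q L) II I k l i j from-I

    edge⇒leap : ∀ x y → SymClosure (Step m) x y → Leap A (q L) (position y ⊖ position x)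
    edge⇒leap x y (fwd s) = step⇒leap x y s
    edge⇒leap x y (bwd s) = leap-sym A (q L) {u = position x} {v = position y} (step⇒leap y x s)

  -- The board of order n as the image of the cells

  module Board (n : ℕ) where

    private
      N : ℤ
      N = + n

      scale : ∀ b {s t} → s ≤ t → b + + 4 * Q * s ≤ b + + 4 * Q * t
      scale b s≤t = ℤ.+-monoʳ-≤ b (ℤ.*-monoˡ-≤-nonNeg (+ 4 * Q) s≤t)

      unscale : ∀ b {s t} → b + + 4 * Q * s ≤ b + + 4 * Q * t → s ≤ t
      unscale b {s} {t} le = ℤ.*-cancelˡ-≤-pos s t (+ 4 * Q)
        (≤-by le (cancel b (+ 4 * Q * s) (+ 4 * Q * t)))
        where
        cancel : ∀ b x y → (b + y) - (b + x) ≡ y - x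
        cancel = solve-∀

      -- Each bound of the rectangle has the form b + 4 Q s, as does the quantity
      -- it bounds, with the same b.
      sum-at : ∀ P Q i j → (P + Q + + 4 * Q * i) + (P - Q + + 4 * Q * j)
                         ≡ + 2 * P + + 4 * Q * (i + j)
      sum-at = solve-∀
      diff-at : ∀ P Q i j → (P - Q + + 4 * Q * j) - (P + Q + + 4 * Q * i)
                          ≡ - (+ 2 * Q) + + 4 * Q * (j - i)
      diff-at = solve-∀
      sum-lower-at : ∀ P Q → + 2 * P ≡ + 2 * P + + 4 * Q * 0ℤ
      sum-lower-at = solve-∀
      sum-upper-at : ∀ P Q n → + 2 * (P + + 2 * n * Q) ≡ + 2 * P + + 4 * Q * n
      sum-upper-at = solve-∀
      diff-lower-at : ∀ Q n → - (+ 2 * ((+ 2 * n - + 1) * Q)) ≡ - (+ 2 * Q) + + 4 * Q * (1ℤ - n)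
      diff-lower-at = solve-∀
      diff-upper-at : ∀ Q n → + 2 * ((+ 2 * n - + 1) * Q) ≡ - (+ 2 * Q) + + 4 * Q * n
      diff-upper-at = solve-∀

      -- The condition R¹ n L as a condition on doubled coordinates.
      Rectangle : ℤ × ℤ → Set
      Rectangle (x , y) =
          + 2 * P ≤ x + y
        × x + y ≤ + 2 * (P + + 2 * N * Q)
        × - (+ 2 * ((+ 2 * N - + 1) * Q)) ≤ y - x
        × y - x ≤ + 2 * ((+ 2 * N - + 1) * Q)

      rectangle⇒region : ∀ {i j} → Rectangle (position (I , i , j)) → Region N i j
      rectangle⇒region {i} {j} (lo , hi , lo′ , hi′) = record
        { sum-lower  = unscale (+ 2 * P) (subst₂ _≤_ (sum-lower-at P Q) (sum-at P Q i j) lo)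
        ; sum-upper  = unscale (+ 2 * P) (subst₂ _≤_ (sum-at P Q i j) (sum-upper-at P Q N) hi)
        ; diff-lower = unscale (- (+ 2 * Q)) (subst₂ _≤_ (diff-lower-at Q N) (diff-at P Q i j) lo′)
        ; diff-upper = unscale (- (+ 2 * Q)) (subst₂ _≤_ (diff-at P Q i j) (diff-upper-at Q N) hi′)
        }

      region⇒rectangle : ∀ {i j} → Region N i j → Rectangle (position (I , i , j))
      region⇒rectangle {i} {j} D =
        subst₂ _≤_ (sym (sum-lower-at P Q)) (sym (sum-at P Q i j))
          (scale (+ 2 * P) (sum-lower D)) ,
        subst₂ _≤_ (sym (sum-at P Q i j)) (sym (sum-upper-at P Q N))
          (scale (+ 2 * P) (sum-upper D)) ,
        subst₂ _≤_ (sym (diff-lower-at Q N)) (sym (diff-at P Q i j))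
          (scale (- (+ 2 * Q)) (diff-lower D)) ,
        subst₂ _≤_ (sym (diff-at P Q i j)) (sym (diff-upper-at Q N))
          (scale (- (+ 2 * Q)) (diff-upper D))

      progression : ∀ {x b} i → x - b ≡ i * (+ 4 * Q) → x ≡ b + + 4 * Q * i
      progression {x} {b} i eq = trans (uncancel x b)
        (trans (cong (λ z → b + z) eq) (cong (λ z → b + z) (ℤ.*-comm i (+ 4 * Q))))
        where
        uncancel : ∀ x b → x ≡ b + (x - b)
        uncancel = solve-∀

      progression⁻¹ : ∀ {x b} i → x ≡ b + + 4 * Q * i → x - b ≡ i * (+ 4 * Q)
      progression⁻¹ {b = b} i refl = cancel b (+ 4 * Q) i
        where
        cancel : ∀ b z i → b + z * i - b ≡ i * z
        cancel = solve-∀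

    W¹⇒cell : ∀ a → W¹ n L a → ∃₂ λ i j → Region N i j × centre L a ≡ position (I , i , j)
    W¹⇒cell _ ((divides i X≡ , divides j Y≡) , R) =
      i , j , rectangle⇒region (subst Rectangle eq R) , eq
      where eq = cong₂ _,_ (progression i X≡) (progression j Y≡)

    cell⇒W¹ : ∀ a {i j} → Region N i j → centre L a ≡ position (I , i , j) → W¹ n L a
    cell⇒W¹ _ {i} {j} D eq =
      (divides i (progression⁻¹ i (cong proj₁ eq)) , divides j (progression⁻¹ j (cong proj₂ eq))) ,
      subst Rectangle (sym eq) (region⇒rectangle D)

    cell⇒pinwheel : ∀ x → Cells N x → pinwheel n L (square x)
    cell⇒pinwheel (c , i , j) D = go c
      where
      base : W¹ n L (square (I , i , j))
      base = cell⇒W¹ (square (I , i , j)) D (centre-square (I , i , j))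
      image-base : ∀ c → centre L (square (c , i , j)) ≡ rotate c (centre L (square (I , i , j)))
      image-base c =
        trans (centre-square (c , i , j)) (cong (rotate c) (sym (centre-square (I , i , j))))
      go : ∀ c → pinwheel n L (square (c , i , j))
      go I   = inj₁ base
      go II  = inj₂ (inj₁ (square (I , i , j) , base , image-base II))
      go III = inj₂ (inj₂ (inj₁ (square (I , i , j) , base , image-base III)))
      go IV  = inj₂ (inj₂ (inj₂ (square (I , i , j) , base , image-base IV)))

    pinwheel⇒cell : ∀ a → pinwheel n L a → ∃ λ x → Cells N x × square x ≡ a
    pinwheel⇒cell a = λ where
        (inj₁ w)                          → at I a w refl
        (inj₂ (inj₁ (b , w , eq)))        → at II b w eq
        (inj₂ (inj₂ (inj₁ (b , w , eq)))) → at III b w eq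
        (inj₂ (inj₂ (inj₂ (b , w , eq)))) → at IV b w eq
      where
      at : ∀ c b → W¹ n L b → centre L a ≡ rotate c (centre L b) →
           ∃ λ x → Cells N x × square x ≡ a
      at c b w eq =
        let i , j , D , eq′ = W¹⇒cell b w
        in (c , i , j) , D ,
           centre-injective L (trans (centre-square (c , i , j))
             (trans (cong (rotate c) (sym eq′)) (sym eq)))

    -- The last hypothesis says that K is the (A , q)-leaper, in either order.
    leaperGraph-isomorphic : ∀ {A m} K → + A ≡ P + Q * (+ 2 * m) → m ≡ 0ℤ ⊎ m ≡ N →
      (∀ d → Leap (p K) (q K) d ⇔ Leap A (q L) d) →
      Isomorphic (cellGraph N m) (leaperGraph K (pinwheel n L))
    leaperGraph-isomorphic {A} {m} K A≡ m≡0∨N same =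
      isomorphic-by {R = SymClosure (Step m)} {R′ = Move K}
        square (λ {x} → cell⇒pinwheel x) (λ {a} → pinwheel⇒cell a)
        square-injective
        λ {x} {y} Dx Dy → mk⇔
          (λ edge → Equivalence.from (move⇔leap L K (square x) (square y))
            (Equivalence.from (same (centre L (square y) ⊖ centre L (square x)))
              (subst₂ (λ u v → Leap A (q L) (v ⊖ u)) (sym (centre-square x)) (sym (centre-square y))
                (edge⇒leap A≡ m≡0∨N x y edge))))
          (λ move → leap⇒edge A≡ m≡0∨N (proj₁ x) (proj₁ y) Dx Dy
            (subst₂ (λ u v → Leap A (q L) (v ⊖ u)) (centre-square x) (centre-square y)
              (Equivalence.to (same (centre L (square y) ⊖ centre L (square x)))
                (Equivalence.to (move⇔leap L K (square x) (square y)) move))))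

-- Opened only here because the lists of variables passed to the ring solver
-- need [] and _∷_ to be unambiguous.
open import Data.Vec.Base using ([]; _∷_; head; tail)

theorem23 : (n : ℕ) → 0 < n → (L M : Leaper) → p L < q L →
    p M ∷ q M ∷ [] ≡ A-pinwheel n *ᵥ (p L ∷ q L ∷ []) →
    Dual (pinwheel n L) L M
theorem23 n 0<n L M p<q M≡ = record
  { distinct   = distinct
  ; nontrivial = square x , square y , cell⇒pinwheel x D , cell⇒pinwheel y D , x≢y
  ; connectedˡ = connected-resp-isomorphic isoᴸ connected
  ; connectedʳ = connected-resp-isomorphic isoᴹ (connected-resp-isomorphic isoᶜ connected)
  ; isomorphic = isomorphic-trans Gᴸ C₀ Gᴹ
      (isomorphic-sym {R = SymClosure (Step 0ℤ)} {R′ = Move L} isoᴸ)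
      (isomorphic-trans C₀ Cₙ Gᴹ isoᶜ isoᴹ)
  }
  where
  open Pinwheel L p<q
  open Board n

  C₀ Cₙ Gᴸ Gᴹ : Graph
  C₀ = cellGraph (+ n) 0ℤ
  Cₙ = cellGraph (+ n) (+ n)
  Gᴸ = leaperGraph L (pinwheel n L)
  Gᴹ = leaperGraph M (pinwheel n L)

  r≡ : p M ≡ q L
  r≡ = trans (cong head M≡) (trans (ℕ.+-identityʳ (1 ℕ.* q L)) (ℕ.*-identityˡ (q L)))

  s≡ : q M ≡ p L ℕ.+ 2 ℕ.* n ℕ.* q L
  s≡ = trans (cong (head ∘ tail) M≡)
    (cong₂ ℕ._+_ (ℕ.*-identityˡ (p L)) (ℕ.+-identityʳ (2 ℕ.* n ℕ.* q L)))

  p<s : p L < q M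
  p<s = ℕ.<-≤-trans p<q (ℕ.≤-trans (ℕ.m≤n*m (q L) (2 ℕ.* n))
    (subst (2 ℕ.* n ℕ.* q L ℕ.≤_) (sym s≡) (ℕ.m≤n+m _ (p L))))
    where
    instance
      2n-nonZero : ℕ.NonZero (2 ℕ.* n)
      2n-nonZero = ℕ.m*n≢0 2 n {{_}} {{ℕ.>-nonZero 0<n}}

  distinct : ¬ (L ≈ᴸ M)
  distinct (inj₁ (p≡r , _)) = ℕ.<⇒≢ p<q (trans p≡r r≡)
  distinct (inj₂ (p≡s , _)) = ℕ.<⇒≢ p<s p≡s

  +s≡ : + q M ≡ + p L + + q L * (+ 2 * + n)
  +s≡ = trans (cong +_ s≡) (cong (λ z → + p L + z)
    (trans (ℤ.pos-* (2 ℕ.* n) (q L))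
      (trans (cong (_* + q L) (ℤ.pos-* 2 n)) (ℤ.*-comm (+ 2 * + n) (+ q L)))))

  +p≡ : + p L ≡ + p L + + q L * (+ 2 * 0ℤ)
  +p≡ = sym (trans (cong (λ z → + p L + z) (ℤ.*-zeroʳ (+ q L))) (ℤ.+-identityʳ (+ p L)))

  isoᴸ : Isomorphic C₀ Gᴸ
  isoᴸ = leaperGraph-isomorphic L +p≡ (inj₁ refl) (λ _ → mk⇔ id id)

  isoᴹ : Isomorphic Cₙ Gᴹ
  isoᴹ = leaperGraph-isomorphic M +s≡ (inj₂ refl) λ d →
    subst (λ r → Leap r (q M) d ⇔ Leap (q M) (q L) d) (sym r≡) (mk⇔ Sum.swap Sum.swap)

  isoᶜ : Isomorphic C₀ Cₙ
  isoᶜ = subst (λ m → Isomorphic C₀ (cellGraph (+ n) m))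
    (ℤ.+-identityʳ (+ n)) (cellGraph-isomorphic n 0ℤ)

  1≤n : 1ℤ ≤ + n
  1≤n = +≤+ 0<n

  connected : Connected C₀
  connected = cellGraph-connected 1≤n

  x y : Cell
  x = I , 0ℤ , 0ℤ
  y = II , 0ℤ , 0ℤ

  D : Region (+ n) 0ℤ 0ℤ
  D = origin-region 1≤n

  x≢y : square x ≢ square y
  x≢y eq with square-injective {x} {y} eq
  ... | ()
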